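{- Let $G$ be a super edge-magic graph of size $|E(G)| = 2|V(G)|-4$. Then $|\sigma_G| = 2$, where $\sigma_G$ is the super edge-magic set of $G$.
   Context: Graphs are finite and simple. The notation $[a,b]$ denotes the set of integers $x$ with $a\le x\le b$. An edge-magic labeling of a graph $G$ is a bijection $f:V(G)\cup E(G)\to[1,|V(G)|+|E(G)|]$ such that $f(u)+f(v)+f(uv)$ equals a constant (the valence $\mathrm{val}(f)$ of $f$) for every $uv\in E(G)$. It is super edge-magic if moreover $f(V(G))=[1,|V(G)|]$, and $G$ is super edge-magic if it admits a super edge-magic labeling. For a graph $G$ of order $p$ and size $q$ (with $q\geq 1$, so that the expression below makes sense), let $$S_G=\left\{\frac{\sum_{u\in V(G)}\deg(u)g(u)+\sum_{i=p+1}^{p+q} i}{q} : g:V(G)\to[1,p]\text{ bijective}\right\}.$$ If $\lceil\min S_G\rceil\le\lfloor\max S_G\rfloor$, the super edge-magic interval of $G$ is $I_G=[\lceil\min S_G\rceil,\lfloor\max S_G\rfloor]$. The super edge-magic set of $G$ is $$\sigma_G=\{k\in I_G : \text{there exists a super edge-magic labeling of } G\text{ with valence } k\}.$$ -}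

module Defs where

open import Data.Fin.Base as Fin using (Fin; toℕ)
open import Data.Fin.Properties using (_≟_)
open import Data.Integer.Base as ℤ using (ℤ; +_)
open import Data.List.Base using (length; filter; allFin)
open import Data.List.Membership.Propositional using () renaming (_∈_ to _∈ˡ_)
open import Data.List.Relation.Unary.Unique.Propositional using (Unique)
open import Data.Nat.Base using (ℕ; _+_; _*_; _≤_; NonZero)
open import Data.Nat.Properties using (+-0-commutativeMonoid)
open import Data.Product.Base using (_×_; _,_; ∃; ∃-syntax; proj₁; proj₂)
open import Data.Rational.Base as ℚ using (ℚ; floor; ceiling)
open import Data.Sum.Base using (_⊎_; inj₁; inj₂)
open import Function.Bundles using (_⇔_)
open import Function.Definitions using (Injective)
open import Level using (0ℓ)
open import Relation.Binary.PropositionalEquality.Core using (_≡_)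
open import Relation.Nullary.Decidable.Core using (Dec; _⊎-dec_)
open import Relation.Unary using (Pred; _∈_)

open import Algebra.Properties.CommutativeMonoid.Sum +-0-commutativeMonoid
  using (sum-syntax)

-- A finite simple graph with V(G) = Fin order and E(G) = Fin size.  The edge e
-- is the unordered pair of its two ends, stored smaller end first: `ordered`
-- excludes loops and, together with `simple`, excludes multiple edges.
record Graph : Set where
  field
    order   : ℕ
    size    : ℕ
    ends    : Fin size → Fin order × Fin order
    ordered : ∀ e → proj₁ (ends e) Fin.< proj₂ (ends e)
    simple  : Injective _≡_ _≡_ ends

  V E : Set
  V = Fin order
  E = Fin size

  end₁ end₂ : E → V
  end₁ e = proj₁ (ends e)
  end₂ e = proj₂ (ends e)

  Incident : V → E → Set
  Incident u e = u ≡ end₁ e ⊎ u ≡ end₂ e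

  incident? : ∀ u e → Dec (Incident u e)
  incident? u e = (u ≟ end₁ e) ⊎-dec (u ≟ end₂ e)

  deg : V → ℕ
  deg u = length (filter (incident? u) (allFin size))

open Graph public

_∈[_,_] : ℕ → ℕ → ℕ → Set
x ∈[ a , b ] = a ≤ x × x ≤ b

-- f, viewed as a map into the interval [a, b], is a bijection.
record BijectiveOnto {A : Set} (f : A → ℕ) (a b : ℕ) : Set where
  field
    inRange    : ∀ x → f x ∈[ a , b ]
    injective  : Injective _≡_ _≡_ f
    surjective : ∀ {y} → y ∈[ a , b ] → ∃[ x ] f x ≡ y

-- The valence is a function of the labeling as soon as G has an edge.
record EdgeMagicLabeling (G : Graph) : Set where
  field
    label     : V G ⊎ E G → ℕ
    bijective : BijectiveOnto label 1 (order G + size G)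
    val       : ℕ
    magic     : ∀ e → label (inj₁ (end₁ G e)) + label (inj₁ (end₂ G e))
                        + label (inj₂ e) ≡ val

-- `super` says that the image of V(G) is exactly [1, |V(G)|].
record SuperEdgeMagicLabeling (G : Graph) : Set where
  field
    edgeMagic : EdgeMagicLabeling G
  open EdgeMagicLabeling edgeMagic public
  field
    super : ∀ y → (∃[ u ] label (inj₁ u) ≡ y) ⇔ y ∈[ 1 , order G ]

IsSuperEdgeMagic : Graph → Set
IsSuperEdgeMagic = SuperEdgeMagicLabeling

IsMin IsMax : Pred ℚ 0ℓ → ℚ → Set
IsMin S m = m ∈ S × (∀ {x} → x ∈ S → m ℚ.≤ x)
IsMax S m = m ∈ S × (∀ {x} → x ∈ S → x ℚ.≤ m)

HasCardinality : Pred ℤ 0ℓ → ℕ → Set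
HasCardinality P n =
  ∃[ ks ] Unique ks × length ks ≡ n × (∀ k → (k ∈ P) ⇔ (k ∈ˡ ks))

module _ (G : Graph) .{{_ : NonZero (size G)}} where

  -- The second sum is that of the integers from p + 1 to p + q.
  S-value : (V G → ℕ) → ℚ
  S-value g = + ( (∑[ u < order G ] (deg G u * g u))
                + (∑[ i < size G ] (order G + 1 + toℕ i))) ℚ./ size G

  S : Pred ℚ 0ℓ
  S x = ∃[ g ] BijectiveOnto g 1 (order G) × x ≡ S-value g

  -- When ⌈ min S ⌉ exceeds ⌊ max S ⌋, the super edge-magic interval is
  -- undefined; here it is then empty.
  I : Pred ℤ 0ℓ
  I k = ∃[ m ] ∃[ M ] IsMin S m × IsMax S M
          × ceiling m ℤ.≤ k × k ℤ.≤ floor M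

  σ : Pred ℤ 0ℓ
  σ k = k ∈ I × ∃ λ (f : SuperEdgeMagicLabeling G) →
          + SuperEdgeMagicLabeling.val f ≡ k

{-# OPTIONS --safe #-}

-- The values f(u) + f(v) over the edges uv are 2p - 4 consecutive integers
-- between 1 + 2 and (p - 1) + p, a range of 2p - 3 integers.  Hence they fill
-- either all but its last or all but its first integer, and the valence is
-- p + q + 3 or p + q + 4.  Reflecting vertex labels in [1, p] and edge labels in
-- [p + 1, p + q] gives another super edge-magic labeling and exchanges the two
-- cases.  Every valence lies in the super edge-magic interval, because summing
-- the magic condition over all edges shows that it is an element of S_G.
module Submission where

open import Defs
open import Data.Bool.Base using (if_then_else_)
open import Data.Fin.Base as Fin using (Fin; zero; suc; toℕ; fromℕ<)
open import Data.Fin.Permutation using (Permutation′; permutation)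
open import Data.Fin.Properties as Fin
  using (toℕ<n; toℕ-injective; toℕ-fromℕ<; any?; all?)
open import Data.Integer.Base as ℤ using (ℤ)
import Data.Integer.DivMod as ℤ
import Data.Integer.Properties as ℤ
open import Data.List.Base
  using (List; []; _∷_; length; filter; tabulate; cartesianProductWith; upTo)
import Data.List.Extrema as Extrema
open import Data.List.Membership.Propositional using () renaming (_∈_ to _∈ˡ_)
open import Data.List.Membership.Propositional.Properties
  using (∈-cartesianProductWith⁺; ∈-upTo⁺; ∈-filter⁺)
import Data.List.Relation.Unary.All as All
open import Data.List.Relation.Unary.All.Properties using (all-filter)
open import Data.List.Relation.Unary.AllPairs using ([]; _∷_)
open import Data.List.Relation.Unary.Any using (here; there)
open import Data.Nat.Base
open import Data.Nat.Coprimality using (1-coprimeTo) renaming (sym to coprime-sym)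
open import Data.Nat.Properties
open import Data.Nat.Tactic.RingSolver using (solve-∀)
open import Data.Product.Base using (_×_; _,_; ∃-syntax; proj₁; proj₂)
open import Data.Rational.Base as ℚ using (ℚ; mkℚ; ↥_; ↧_; floor; ceiling)
import Data.Rational.Properties as ℚ
import Data.Rational.Unnormalised.Base as ℚᵘ
open import Data.Sum.Base using (_⊎_; inj₁; inj₂; [_,_]′)
open import Data.Sum.Properties using (inj₁-injective; inj₂-injective)
open import Data.Vec.Base as Vec using (Vec; []; _∷_; lookup)
open import Data.Vec.Properties using (lookup∘tabulate)
open import Function.Base using (_∘_; _$_)
open import Function.Bundles using (mk⇔; module Equivalence)
open import Relation.Binary.Bundles using (module DecTotalOrder)
open import Relation.Binary.PropositionalEquality
  using (_≡_; _≢_; refl; sym; trans; cong; cong₂; subst; subst₂; module ≡-Reasoning)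
open import Relation.Nullary.Decidable
  using (Dec; yes; no; does; map′; _×-dec_; _→-dec_; _⊎-dec_)
open import Relation.Nullary.Negation using (¬_; contradiction)
open import Relation.Unary using (Decidable; _∈_)

open import Algebra.Properties.Semiring.Sum +-*-semiring

open Equivalence using (to; from)
open BijectiveOnto

-- Bijections onto intervals

BijectiveOnto-cong : ∀ {A : Set} {g h : A → ℕ} {a b} → (∀ x → g x ≡ h x) →
                     BijectiveOnto g a b → BijectiveOnto h a b
BijectiveOnto-cong {a = a} {b} g≗h bij = record
  { inRange    = λ x → subst (_∈[ a , b ]) (g≗h x) (bij .inRange x)
  ; injective  = λ {x} {y} eq →
      bij .injective (trans (g≗h x) (trans eq (sym (g≗h y))))
  ; surjective = λ y∈ →
      let x , eq = bij .surjective y∈ in x , trans (sym (g≗h x)) eq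
  }

-- The map sending y to a + b - y is an involution of [a, b], so `reflect-range` serves both the
-- range and the surjectivity. Truncation never occurs, since every value is at most a + b.
BijectiveOnto-reflect : ∀ {A : Set} {g : A → ℕ} {a b} → BijectiveOnto g a b →
                        BijectiveOnto (λ x → a + b ∸ g x) a b
BijectiveOnto-reflect {g = g} {a} {b} bij = record
  { inRange    = λ x → reflect-range (bij .inRange x)
  ; injective  = λ {x} {y} → bij .injective ∘ ∸-cancelˡ-≡ (bound x) (bound y)
  ; surjective = λ {y} y∈ →
      let x , eq = bij .surjective (reflect-range y∈) in
      x , trans (cong (a + b ∸_) eq) (m∸[m∸n]≡n (m≤n⇒m≤o+n a (proj₂ y∈)))
  }
  where
  bound : ∀ x → g x ≤ a + b
  bound x = m≤n⇒m≤o+n a (proj₂ (bij .inRange x))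

  reflect-range : ∀ {y} → y ∈[ a , b ] → (a + b ∸ y) ∈[ a , b ]
  reflect-range {y} (a≤y , y≤b) =
    m+n≤o⇒m≤o∸n a (+-monoʳ-≤ a y≤b) , m≤n+o⇒m∸n≤o (a + b) y (+-monoˡ-≤ b a≤y)

-- The intervals [a, b] and [suc b, c] tile [a, c]; the two inequalities on the bounds allow either
-- of them to be empty.
BijectiveOnto-⊎ : ∀ {A B : Set} {g : A → ℕ} {h : B → ℕ} {a b c} →
                  a ≤ suc b → b ≤ c →
                  BijectiveOnto g a b → BijectiveOnto h (suc b) c →
                  BijectiveOnto [ g , h ]′ a c
BijectiveOnto-⊎ {A} {B} {g} {h} {a} {b} {c} a≤1+b b≤c bijᵍ bijʰ = record
  { inRange    = range
  ; injective  = λ {x} {y} → inj x y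
  ; surjective = surj
  }
  where
  range : ∀ x → [ g , h ]′ x ∈[ a , c ]
  range (inj₁ x) = let l , u = bijᵍ .inRange x in l , ≤-trans u b≤c
  range (inj₂ y) = let l , u = bijʰ .inRange y in ≤-trans a≤1+b l , u

  g<h : ∀ x y → g x < h y
  g<h x y = ≤-<-trans (proj₂ (bijᵍ .inRange x)) (proj₁ (bijʰ .inRange y))

  inj : ∀ x y → [ g , h ]′ x ≡ [ g , h ]′ y → x ≡ y
  inj (inj₁ x) (inj₁ y) eq = cong inj₁ (bijᵍ .injective eq)
  inj (inj₁ x) (inj₂ y) eq = contradiction eq (<⇒≢ (g<h x y))
  inj (inj₂ x) (inj₁ y) eq = contradiction (sym eq) (<⇒≢ (g<h y x))
  inj (inj₂ x) (inj₂ y) eq = cong inj₂ (bijʰ .injective eq)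

  surj : ∀ {y} → y ∈[ a , c ] → ∃[ x ] [ g , h ]′ x ≡ y
  surj {y} (a≤y , y≤c) with y ≤? b
  ... | yes y≤b = let x , eq = bijᵍ .surjective (a≤y , y≤b) in inj₁ x , eq
  ... | no  y≰b = let x , eq = bijʰ .surjective (≰⇒> y≰b , y≤c) in inj₂ x , eq

-- Subtracting `suc a` from the values of `g` yields a permutation of `Fin n`, and sums are
-- invariant under permutation. The summand has the shape used in `S-value`.
sum-BijectiveOnto : ∀ {n} a (g : Fin n → ℕ) → BijectiveOnto g (suc a) (a + n) →
                    sum g ≡ ∑[ i < n ] (a + 1 + toℕ i)
sum-BijectiveOnto {n} a g bij = begin
  sum g                             ≡⟨ sum-cong-≗ g≗shift∘index ⟩
  sum (λ x → shift (index x))       ≡⟨ sum-permute shift π ⟨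
  sum shift                         ∎
  where
  open ≡-Reasoning

  shift : Fin n → ℕ
  shift i = a + 1 + toℕ i

  shift≡ : ∀ i → shift i ≡ suc a + toℕ i
  shift≡ i = cong (_+ toℕ i) (+-comm a 1)

  lower : ∀ x → suc a ≤ g x
  lower x = proj₁ (bij .inRange x)

  g∸a<n : ∀ x → g x ∸ suc a < n
  g∸a<n x = subst (_≤ n) (+-∸-assoc 1 (lower x))
    (m≤n+o⇒m∸n≤o (suc (g x)) (suc a) (s≤s (proj₂ (bij .inRange x))))

  index : Fin n → Fin n
  index x = fromℕ< (g∸a<n x)

  g≗shift∘index : ∀ x → g x ≡ shift (index x)
  g≗shift∘index x = begin
    g x                        ≡⟨ m+[n∸m]≡n (lower x) ⟨
    suc a + (g x ∸ suc a)      ≡⟨ cong (suc a +_) (toℕ-fromℕ< (g∸a<n x)) ⟨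
    suc a + toℕ (index x)      ≡⟨ shift≡ (index x) ⟨
    shift (index x)            ∎

  preimage : ∀ i → ∃[ x ] g x ≡ shift i
  preimage i = bij .surjective
    ( subst (suc a ≤_) (sym (shift≡ i)) (m≤m+n (suc a) (toℕ i))
    , subst (_≤ a + n) (sym (trans (shift≡ i) (sym (+-suc a (toℕ i)))))
        (+-monoʳ-≤ a (toℕ<n i)))

  π : Permutation′ n
  π = permutation index (proj₁ ∘ preimage)
    (λ i → toℕ-injective (+-cancelˡ-≡ (a + 1) _ _
      (trans (sym (g≗shift∘index _)) (proj₂ (preimage i)))))
    (λ x → bij .injective (trans (proj₂ (preimage (index x)))
      (sym (g≗shift∘index x))))

-- Each field is a finite check: two quantify over `Fin n`, and surjectivity concerns only y < suc
-- b. This allows filtering a finite list of candidates.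
bijectiveOnto? : ∀ {n} (g : Fin n → ℕ) a b → Dec (BijectiveOnto g a b)
bijectiveOnto? g a b = map′
  (λ (r , i , s) → record
    { inRange    = r
    ; injective  = λ {x} {y} → i x y
    ; surjective = λ (l , u) → s (s≤s u) l
    })
  (λ bij → bij .inRange , (λ x y → bij .injective) ,
           λ {y} y<1+b a≤y → bij .surjective {y} (a≤y , s≤s⁻¹ y<1+b))
  (all? (λ x → (a ≤? g x) ×-dec (g x ≤? b))
   ×-dec all? (λ x → all? (λ y → (g x ≟ g y) →-dec (x Fin.≟ y)))
   ×-dec allUpTo? (λ y → (a ≤? y) →-dec any? (λ x → g x ≟ y)) (suc b))

-- Extrema over the bijections onto an interval

vectorsOver : ∀ {A : Set} → List A → ∀ n → List (Vec A n)
vectorsOver xs zero    = [] ∷ []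
vectorsOver xs (suc n) = cartesianProductWith _∷_ xs (vectorsOver xs n)

tabulate∈vectorsOver : ∀ {A : Set} {xs : List A} {n} {g : Fin n → A} →
                       (∀ i → g i ∈ˡ xs) → Vec.tabulate g ∈ˡ vectorsOver xs n
tabulate∈vectorsOver {n = zero}  g∈ = here refl
tabulate∈vectorsOver {n = suc n} g∈ =
  ∈-cartesianProductWith⁺ _∷_ (g∈ zero) (tabulate∈vectorsOver (g∈ ∘ suc))

-- Functions cannot be listed up to ≡, so the candidates are listed as vectors,
-- and w must respect pointwise equality.
module BijectionExtrema {n a b} (w : (Fin n → ℕ) → ℚ)
  (w-cong : ∀ {g h} → (∀ i → g i ≡ h i) → w g ≡ w h)
  {g₀ : Fin n → ℕ} (bij₀ : BijectiveOnto g₀ a b) where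

  open Extrema (DecTotalOrder.totalOrder ℚ.≤-decTotalOrder)

  private
    bij? : Decidable (λ (v : Vec ℕ n) → BijectiveOnto (lookup v) a b)
    bij? v = bijectiveOnto? (lookup v) a b

    candidates : List (Vec ℕ n)
    candidates = filter bij? (vectorsOver (upTo (suc b)) n)

    tabulate-bijective : ∀ {g : Fin n → ℕ} → BijectiveOnto g a b →
                         BijectiveOnto (lookup (Vec.tabulate g)) a b
    tabulate-bijective {g} = BijectiveOnto-cong (sym ∘ lookup∘tabulate g)

    tabulate∈candidates : ∀ {g : Fin n → ℕ} → BijectiveOnto g a b →
                          Vec.tabulate g ∈ˡ candidates
    tabulate∈candidates bij = ∈-filter⁺ bij?
      (tabulate∈vectorsOver (λ i → ∈-upTo⁺ (s≤s (proj₂ (bij .inRange i)))))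
      (tabulate-bijective bij)

    v₀ : Vec ℕ n
    v₀ = Vec.tabulate g₀

    w′ : Vec ℕ n → ℚ
    w′ = w ∘ lookup

    w′-tabulate : ∀ (g : Fin n → ℕ) → w′ (Vec.tabulate g) ≡ w g
    w′-tabulate g = w-cong (lookup∘tabulate g)

  minimum : ∃[ g ] BijectiveOnto g a b ×
              (∀ {h} → BijectiveOnto h a b → w g ℚ.≤ w h)
  minimum = lookup v , v-bijective , least
    where
    -- `v₀` is the default that `argmin` returns when no candidate improves on it; being bijective
    -- itself, it keeps the result bijective in every case.
    v = argmin w′ v₀ candidates

    v-bijective : BijectiveOnto (lookup v) a b
    v-bijective = argmin-all w′ {v₀} {candidates}
      {λ v → BijectiveOnto (lookup v) a b}
      (tabulate-bijective bij₀) (all-filter bij? (vectorsOver (upTo (suc b)) n))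

    least : ∀ {h} → BijectiveOnto h a b → w′ v ℚ.≤ w h
    least {h} bij = subst (w′ v ℚ.≤_) (w′-tabulate h)
      (All.lookup (f[argmin]≤f[xs] {f = w′} v₀ candidates)
        (tabulate∈candidates bij))

  maximum : ∃[ g ] BijectiveOnto g a b ×
              (∀ {h} → BijectiveOnto h a b → w h ℚ.≤ w g)
  maximum = lookup v , v-bijective , greatest
    where
    v = argmax w′ v₀ candidates

    v-bijective : BijectiveOnto (lookup v) a b
    v-bijective = argmax-all w′ {λ v → BijectiveOnto (lookup v) a b}
      {v₀} {candidates}
      (tabulate-bijective bij₀) (all-filter bij? (vectorsOver (upTo (suc b)) n))

    greatest : ∀ {h} → BijectiveOnto h a b → w h ℚ.≤ w′ v
    greatest {h} bij = subst (ℚ._≤ w′ v) (w′-tabulate h)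
      (All.lookup (f[xs]≤f[argmax] {f = w′} v₀ candidates)
        (tabulate∈candidates bij))

-- Floors and ceilings

-- Written as a reduced fraction, so that numerator and denominator compute to `k` and 1.
fromℕ : ℕ → ℚ
fromℕ k = mkℚ (ℤ.+ k) 0 (coprime-sym (1-coprimeTo k))

[k*n]/n≡fromℕ : ∀ k n .{{_ : NonZero n}} → ℤ.+ (k * n) ℚ./ n ≡ fromℕ k
[k*n]/n≡fromℕ k (suc n) = trans
  (ℚ.fromℚᵘ-cong {ℚᵘ.mkℚᵘ (ℤ.+ (k * suc n)) n} {ℚᵘ.mkℚᵘ (ℤ.+ k) 0}
    (ℚᵘ.*≡* (trans (ℤ.*-identityʳ _) (ℤ.pos-* k (suc n)))))
  (ℚ.normalize-coprime (coprime-sym (1-coprimeTo k)))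

-- The floor is the integer quotient of numerator n by denominator d, and n < (floor + 1) * d.
-- Cancelling d leaves k < floor + 1.
*↧≤↥⇒≤floor : ∀ k x → k ℤ.* ↧ x ℤ.≤ ↥ x → k ℤ.≤ floor x
*↧≤↥⇒≤floor k (mkℚ n d-1 _) k*d≤n =
  subst (k ℤ.≤_) (sym (ℤ.div-pos-is-/ℕ n d)) $
  subst (k ℤ.≤_) (ℤ.pred-suc (n ℤ./ℕ d)) $
  ℤ.i<j⇒i≤pred[j] $
  ℤ.*-cancelʳ-<-nonNeg {k} {ℤ.suc (n ℤ./ℕ d)} (ℤ.+ d) $
  ℤ.≤-<-trans k*d≤n (ℤ.n<s[n/ℕd]*d n d)
  where d = suc d-1

fromℕ≤⇒≤floor : ∀ {k x} → fromℕ k ℚ.≤ x → ℤ.+ k ℤ.≤ floor x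
fromℕ≤⇒≤floor {k} {x} (ℚ.*≤* le) =
  *↧≤↥⇒≤floor (ℤ.+ k) x (subst (ℤ.+ k ℤ.* ↧ x ℤ.≤_) (ℤ.*-identityʳ (↥ x)) le)

-- The ceiling of x is minus the floor of - x, so negating the inequality reduces it to
-- `*↧≤↥⇒≤floor`.
≤fromℕ⇒ceiling≤ : ∀ {k x} → x ℚ.≤ fromℕ k → ceiling x ℤ.≤ ℤ.+ k
≤fromℕ⇒ceiling≤ {k} {x@record{}} (ℚ.*≤* le) =
  subst (ceiling x ℤ.≤_) (ℤ.neg-involutive (ℤ.+ k)) $ ℤ.neg-mono-≤ $
  *↧≤↥⇒≤floor (ℤ.- (ℤ.+ k)) (ℚ.- x) $
  subst₂ ℤ._≤_
    (trans (ℤ.neg-distribˡ-* (ℤ.+ k) (↧ x)) (cong (ℤ.- (ℤ.+ k) ℤ.*_) (sym (ℚ.↧-neg x))))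
    (trans (cong ℤ.-_ (ℤ.*-identityʳ (↥ x))) (sym (ℚ.↥-neg x)))
    (ℤ.neg-mono-≤ le)

-- Double counting of incidences

indicator : ∀ {A : Set} → Dec A → ℕ
indicator A? = if does A? then 1 else 0

indicator-⊎ : ∀ {A B : Set} (A? : Dec A) (B? : Dec B) → (A → ¬ B) →
              indicator (A? ⊎-dec B?) ≡ indicator A? + indicator B?
indicator-⊎ (no _)  B?      _  = refl
indicator-⊎ (yes _) (no _)  _  = refl
indicator-⊎ (yes a) (yes b) ¬b = contradiction b (¬b a)

length-filter-tabulate : ∀ {A : Set} {P : A → Set} (P? : Decidable P)
  {n} (h : Fin n → A) →
  length (filter P? (tabulate h)) ≡ ∑[ i < n ] indicator (P? (h i))
length-filter-tabulate P? {zero}  h = refl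
length-filter-tabulate P? {suc n} h with P? (h zero)
... | yes _ = cong suc (length-filter-tabulate P? (h ∘ suc))
... | no  _ = length-filter-tabulate P? (h ∘ suc)

sum-indicator-≟ : ∀ {n} (g : Fin n → ℕ) j →
                  ∑[ i < n ] (indicator (i Fin.≟ j) * g i) ≡ g j
sum-indicator-≟ {suc n} g zero = begin
  1 * g zero + ∑[ i < n ] (0 * g (suc i)) ≡⟨ cong₂ _+_ (*-identityˡ (g zero)) (sum-replicate-zero n) ⟩
  g zero + 0                              ≡⟨ +-identityʳ (g zero) ⟩
  g zero                                  ∎
  where open ≡-Reasoning
-- The summand at `zero` computes to 0, and the indicator of `suc i ≟ suc j` computes to that of
-- `i ≟ j`.
sum-indicator-≟ {suc n} g (suc j) = sum-indicator-≟ (g ∘ suc) j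

-- Each degree is a sum of incidence indicators. After exchanging the two sums, every edge collects
-- the values of `g` at its two ends.
sum-deg* : ∀ G (g : V G → ℕ) →
  ∑[ u < order G ] (deg G u * g u) ≡ ∑[ e < size G ] (g (end₁ G e) + g (end₂ G e))
sum-deg* G g = begin
  ∑[ u < p ] (deg G u * g u)
    ≡⟨ sum-cong-≗ (λ u → cong (_* g u) (length-filter-tabulate (incident? G u) (λ e → e))) ⟩
  ∑[ u < p ] ((∑[ e < q ] inc u e) * g u)
    ≡⟨ sum-cong-≗ (λ u → *-distribʳ-sum (g u) (inc u)) ⟩
  ∑[ u < p ] ∑[ e < q ] (inc u e * g u)
    ≡⟨ ∑-comm (λ u e → inc u e * g u) ⟩
  ∑[ e < q ] ∑[ u < p ] (inc u e * g u)
    ≡⟨ sum-cong-≗ sum-incident ⟩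
  ∑[ e < q ] (g (end₁ G e) + g (end₂ G e)) ∎
  where
  open ≡-Reasoning
  p = order G
  q = size G

  inc : V G → E G → ℕ
  inc u e = indicator (incident? G u e)

  δ : V G → V G → ℕ
  δ v u = indicator (u Fin.≟ v)

  sum-incident : ∀ e → ∑[ u < p ] (inc u e * g u) ≡ g (end₁ G e) + g (end₂ G e)
  sum-incident e = begin
    ∑[ u < p ] (inc u e * g u)
      -- No loops: the ends of an edge differ, so incidence is a disjoint alternative and its
      -- indicator splits.
      ≡⟨ sum-cong-≗ (λ u → cong (_* g u) (indicator-⊎ (u Fin.≟ x) (u Fin.≟ y)
           (λ u≡x u≡y → Fin.<⇒≢ (ordered G e) (trans (sym u≡x) u≡y)))) ⟩
    ∑[ u < p ] ((δ x u + δ y u) * g u)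
      ≡⟨ sum-cong-≗ (λ u → *-distribʳ-+ (g u) (δ x u) (δ y u)) ⟩
    ∑[ u < p ] (δ x u * g u + δ y u * g u)
      ≡⟨ ∑-distrib-+ (λ u → δ x u * g u) (λ u → δ y u * g u) ⟩
    ∑[ u < p ] (δ x u * g u) + ∑[ u < p ] (δ y u * g u)
      ≡⟨ cong₂ _+_ (sum-indicator-≟ g x) (sum-indicator-≟ g y) ⟩
    g x + g y ∎
    where
    x = end₁ G e
    y = end₂ G e

sum-const : ∀ n k → ∑[ i < n ] k ≡ k * n
sum-const zero    k = sym (*-zeroʳ k)
sum-const (suc n) k = trans (cong (k +_) (sum-const n k)) (sym (*-suc k n))

-- Super edge-magic labelings

open SuperEdgeMagicLabeling

module _ {G : Graph} (f : SuperEdgeMagicLabeling G) where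

  private
    p = order G
    q = size G

  vertexLabel : V G → ℕ
  vertexLabel = label f ∘ inj₁

  edgeLabel : E G → ℕ
  edgeLabel = label f ∘ inj₂

  vertexLabel-bijective : BijectiveOnto vertexLabel 1 p
  vertexLabel-bijective = record
    { inRange    = λ u → to (super f _) (u , refl)
    ; injective  = λ eq → inj₁-injective (bijective f .injective eq)
    ; surjective = from (super f _)
    }

  -- The vertex labels exhaust [1, p], so injectivity of the whole labeling forces edge labels above
  -- p, and labels above p can come only from edges.
  edgeLabel-bijective : BijectiveOnto edgeLabel (suc p) (p + q)
  edgeLabel-bijective = record
    { inRange    = λ e → lower e , proj₂ (bijective f .inRange (inj₂ e))
    ; injective  = λ eq → inj₂-injective (bijective f .injective eq)
    ; surjective = surj
    }
    where
    lower : ∀ e → suc p ≤ edgeLabel e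
    lower e with edgeLabel e ≤? p
    ... | no  ≰p = ≰⇒> ≰p
    ... | yes ≤p
        with u , eq ← from (super f _) (proj₁ (bijective f .inRange (inj₂ e)) , ≤p)
        with () ← bijective f .injective eq

    surj : ∀ {y} → y ∈[ suc p , p + q ] → ∃[ e ] edgeLabel e ≡ y
    surj (p<y , y≤p+q)
      with bijective f .surjective (≤-trans (s≤s z≤n) p<y , y≤p+q)
    ... | inj₂ e , eq   = e , eq
    ... | inj₁ u , refl = contradiction (proj₂ (to (super f _) (u , refl))) (<⇒≱ p<y)

  ends-distinct : ∀ e → vertexLabel (end₁ G e) ≢ vertexLabel (end₂ G e)
  ends-distinct e = Fin.<⇒≢ (ordered G e) ∘ vertexLabel-bijective .injective

  -- A vertex label and its reflection add up to 1 + p, an edge label and its reflection to suc p +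
  -- (p + q). Along an edge, the old and new magic sums thus add up to the total from which `val f`
  -- is subtracted.
  complement-val : ℕ
  complement-val = (1 + p) + (1 + p) + (suc p + (p + q)) ∸ val f

  complement : SuperEdgeMagicLabeling G
  complement = record
    { edgeMagic = record
      { label     = [ (λ u → 1 + p ∸ vertexLabel u)
                    , (λ e → suc p + (p + q) ∸ edgeLabel e) ]′
      ; bijective = BijectiveOnto-⊎ (s≤s z≤n) (m≤m+n p q) vertices
                      (BijectiveOnto-reflect edgeLabel-bijective)
      ; val       = complement-val
      ; magic     = reflected-magic
      }
    ; super = λ y → mk⇔ (λ { (u , refl) → vertices .inRange u }) (vertices .surjective)
    }
    where
    vertices : BijectiveOnto (λ u → 1 + p ∸ vertexLabel u) 1 p
    vertices = BijectiveOnto-reflect vertexLabel-bijective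

    rearrange₆ : ∀ a b c x y z →
      a + b + c + (x + y + z) ≡ (a + x) + (b + y) + (c + z)
    rearrange₆ = solve-∀

    reflected-magic : ∀ e →
      (1 + p ∸ vertexLabel (end₁ G e)) + (1 + p ∸ vertexLabel (end₂ G e))
        + (suc p + (p + q) ∸ edgeLabel e) ≡ complement-val
    reflected-magic e = begin
      -- Adding `val f` in the form x + y + z pairs each reflected label with its original, which
      -- undoes the truncated subtractions one by one.
      a + b + c                                ≡⟨ m+n∸n≡m (a + b + c) (val f) ⟨
      a + b + c + val f ∸ val f                ≡⟨ cong (λ k → a + b + c + k ∸ val f) (magic f e) ⟨
      a + b + c + (x + y + z) ∸ val f          ≡⟨ cong (_∸ val f) (rearrange₆ a b c x y z) ⟩
      (a + x) + (b + y) + (c + z) ∸ val f      ≡⟨ cong (_∸ val f) (cong₂ _+_ (cong₂ _+_ (undo (end₁ G e)) (undo (end₂ G e)))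
                                                    (m∸n+n≡m (m≤n⇒m≤o+n (suc p) (proj₂ (edgeLabel-bijective .inRange e))))) ⟩
      complement-val                           ∎
      where
      open ≡-Reasoning
      x = vertexLabel (end₁ G e)
      y = vertexLabel (end₂ G e)
      z = edgeLabel e
      a = 1 + p ∸ x
      b = 1 + p ∸ y
      c = suc p + (p + q) ∸ z

      undo : ∀ u → (1 + p ∸ vertexLabel u) + vertexLabel u ≡ 1 + p
      undo u = m∸n+n≡m (m≤n⇒m≤o+n 1 (proj₂ (vertexLabel-bijective .inRange u)))

  -- This is the magic condition summed over all edges: a vertex label occurs once per incident
  -- edge, and the edge labels run through p + 1, ..., p + q.
  val*size : (∑[ u < p ] (deg G u * vertexLabel u)) + (∑[ i < q ] (p + 1 + toℕ i))
             ≡ val f * q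
  val*size = begin
    (∑[ u < p ] (deg G u * vertexLabel u)) + (∑[ i < q ] (p + 1 + toℕ i))
      ≡⟨ cong₂ _+_ (sum-deg* G vertexLabel)
           (sym (sum-BijectiveOnto p edgeLabel edgeLabel-bijective)) ⟩
    (∑[ e < q ] endSum e) + sum edgeLabel
      ≡⟨ ∑-distrib-+ endSum edgeLabel ⟨
    ∑[ e < q ] (endSum e + edgeLabel e)
      ≡⟨ sum-cong-≗ (magic f) ⟩
    ∑[ e < q ] val f
      ≡⟨ sum-const q (val f) ⟩
    val f * q ∎
    where
    open ≡-Reasoning
    endSum : E G → ℕ
    endSum e = vertexLabel (end₁ G e) + vertexLabel (end₂ G e)

  module _ .{{_ : NonZero q}} where

    -- The valence is the integer `S-value G vertexLabel`, hence lies between the extrema of `S G`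
    -- even after rounding. The extrema exist because `vertexLabel` supplies one bijection to start
    -- from.
    val∈I : ℤ.+ val f ∈ I G
    val∈I =
      let m , bijᵐ , least    = minimum
          M , bijᴹ , greatest = maximum in
      S-value G m , S-value G M
      , ((m , bijᵐ , refl) , λ { (h , bij , refl) → least bij })
      , ((M , bijᴹ , refl) , λ { (h , bij , refl) → greatest bij })
      , ≤fromℕ⇒ceiling≤ {x = S-value G m}
          (subst (S-value G m ℚ.≤_) S-value≡val (least vertexLabel-bijective))
      , fromℕ≤⇒≤floor {x = S-value G M}
          (subst (ℚ._≤ S-value G M) S-value≡val (greatest vertexLabel-bijective))
      where
      open BijectionExtrema (S-value G)
        (λ g≗h → cong (λ s → ℤ.+ (s + _) ℚ./ q)
          (sum-cong-≗ (λ u → cong (deg G u *_) (g≗h u))))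
        vertexLabel-bijective

      S-value≡val : S-value G vertexLabel ≡ fromℕ (val f)
      S-value≡val = trans (cong (λ s → ℤ.+ s ℚ./ q) val*size) ([k*n]/n≡fromℕ (val f) q)

    val∈σ : ∀ {k} → val f ≡ k → ℤ.+ k ∈ σ G
    val∈σ refl = val∈I , f , refl

    -- Take the edge with the largest label p + q: its ends carry distinct positive labels, whose
    -- sum is at least 1 + 2.
    val-lower : p + q + 3 ≤ val f
    val-lower = begin
      p + q + 3         ≡⟨ +-comm (p + q) 3 ⟩
      3 + (p + q)       ≤⟨ +-mono-≤ (distinct⇒3≤+ (proj₁ (range (end₁ G e)))
                             (proj₁ (range (end₂ G e))) (ends-distinct e))
                             (≤-reflexive (sym eq)) ⟩
      vertexLabel (end₁ G e) + vertexLabel (end₂ G e) + edgeLabel e ≡⟨ magic f e ⟩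
      val f             ∎
      where
      open ≤-Reasoning
      range = vertexLabel-bijective .inRange
      top = edgeLabel-bijective .surjective (m<m+n p (>-nonZero⁻¹ q) , ≤-refl)
      e = proj₁ top
      eq = proj₂ top

      distinct⇒3≤+ : ∀ {a b} → 1 ≤ a → 1 ≤ b → a ≢ b → 3 ≤ a + b
      distinct⇒3≤+ {1}           {1}           _ _ a≢b = contradiction refl a≢b
      distinct⇒3≤+ {1}           {suc (suc b)} _ _ _   = s≤s (s≤s (s≤s z≤n))
      distinct⇒3≤+ {suc (suc a)} {suc b}       _ _ _   =
        s≤s (s≤s (m≤n⇒m≤o+n a (s≤s z≤n)))

    -- Take the edge with the smallest label p + 1: its ends carry distinct labels of at most p,
    -- whose sum is at most (p - 1) + p.
    val-upper : val f ≤ 3 * p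
    val-upper = begin
      val f                     ≡⟨ magic f e ⟨
      x + y + edgeLabel e       ≡⟨ cong (λ z → x + y + z) eq ⟩
      x + y + suc p             ≡⟨ +-suc (x + y) p ⟩
      suc (x + y) + p           ≤⟨ +-monoˡ-≤ p (distinct⇒1++≤ (proj₂ (range (end₁ G e)))
                                     (proj₂ (range (end₂ G e))) (ends-distinct e)) ⟩
      p + p + p                 ≡⟨ triple p ⟩
      3 * p                     ∎
      where
      open ≤-Reasoning
      range = vertexLabel-bijective .inRange
      bottom = edgeLabel-bijective .surjective (≤-refl , m<m+n p (>-nonZero⁻¹ q))
      e = proj₁ bottom
      eq = proj₂ bottom
      x = vertexLabel (end₁ G e)
      y = vertexLabel (end₂ G e)

      triple : ∀ n → n + n + n ≡ 3 * n
      triple = solve-∀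

      distinct⇒1++≤ : ∀ {a b n} → a ≤ n → b ≤ n → a ≢ b → suc (a + b) ≤ n + n
      distinct⇒1++≤ {a} {b} a≤n b≤n a≢b with a <? b
      ... | yes a<b = +-mono-<-≤ (<-≤-trans a<b b≤n) b≤n
      ... | no  a≮b = +-mono-≤-< a≤n (<-≤-trans (≤∧≢⇒< (≮⇒≥ a≮b) (a≢b ∘ sym)) a≤n)

-- The two valences when q = 2p - 4

theorem2p2 : (G : Graph) .{{_ : NonZero (size G)}} →
    IsSuperEdgeMagic G →
    size G + 4 ≡ 2 * order G →
    HasCardinality (σ G) 2
theorem2p2 G sem q+4≡2p =
    ℤ.+ c ∷ ℤ.+ suc c ∷ []
  , ((m≢1+n+m c {0} ∘ ℤ.+-injective) All.∷ All.[]) ∷ All.[] ∷ []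
  , refl
  , λ k → mk⇔ σ⊆ ⊆σ
  where
  p = order G
  q = size G
  c = p + q + 3

  -- The size hypothesis enters here: it makes the upper bound 3p of the valence exceed the lower
  -- bound `c` by exactly one.
  3p≡1+c : 3 * p ≡ suc c
  3p≡1+c = begin
    3 * p        ≡⟨⟩
    p + 2 * p    ≡⟨ cong (p +_) q+4≡2p ⟨
    p + (q + 4)  ≡⟨ lemma p q ⟩
    suc c        ∎
    where
    open ≡-Reasoning
    lemma : ∀ p q → p + (q + 4) ≡ suc (p + q + 3)
    lemma = solve-∀

  -- The valences of a labeling and of its complement therefore sum to c + suc c, so complementation
  -- exchanges `c` and `suc c`.
  reflected-total : (1 + p) + (1 + p) + (suc p + (p + q)) ≡ c + suc c
  reflected-total = begin
    (1 + p) + (1 + p) + (suc p + (p + q)) ≡⟨ lemma p q ⟩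
    3 * p + c                             ≡⟨ cong (_+ c) 3p≡1+c ⟩
    suc c + c                             ≡⟨ +-comm (suc c) c ⟩
    c + suc c                             ∎
    where
    open ≡-Reasoning
    lemma : ∀ p q → (1 + p) + (1 + p) + (suc p + (p + q)) ≡ 3 * p + (p + q + 3)
    lemma = solve-∀

  val-cases : (f : SuperEdgeMagicLabeling G) → val f ≡ c ⊎ val f ≡ suc c
  val-cases f with val f ≤? c
  ... | yes ≤c = inj₁ (≤-antisym ≤c (val-lower f))
  ... | no  ≰c = inj₂ (≤-antisym (subst (val f ≤_) 3p≡1+c (val-upper f)) (≰⇒> ≰c))

  complement-val≡ : ∀ f {m n} → val f ≡ m → m + n ≡ c + suc c → complement-val f ≡ n
  complement-val≡ f {m} {n} refl m+n≡ =
    trans (cong (_∸ m) (trans reflected-total (sym m+n≡))) (m+n∸m≡n m n)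

  both : val sem ≡ c ⊎ val sem ≡ suc c → ℤ.+ c ∈ σ G × ℤ.+ suc c ∈ σ G
  both (inj₁ eq) = val∈σ sem eq
                 , val∈σ (complement sem) (complement-val≡ sem eq refl)
  both (inj₂ eq) = val∈σ (complement sem) (complement-val≡ sem eq (+-comm (suc c) c))
                 , val∈σ sem eq

  σ⊆ : ∀ {k} → k ∈ σ G → k ∈ˡ ℤ.+ c ∷ ℤ.+ suc c ∷ []
  σ⊆ (_ , f , val≡k) =
    [ (λ eq → here (trans (sym val≡k) (cong ℤ.+_ eq)))
    , (λ eq → there (here (trans (sym val≡k) (cong ℤ.+_ eq)))) ]′ (val-cases f)

  ⊆σ : ∀ {k} → k ∈ˡ ℤ.+ c ∷ ℤ.+ suc c ∷ [] → k ∈ σ G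
  ⊆σ (here refl)         = proj₁ (both (val-cases sem))
  ⊆σ (there (here refl)) = proj₂ (both (val-cases sem))
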